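{- Let $G$ be an infinite group and $A\subseteq G$. Then: (i) for $n\in\mathbb{N}$, $A$ is $n$-thin if and only if $|Y|\le n$ for every $Y\in W(A)$; (ii) $A$ is sparse if and only if every $Y\in W(A)$ is finite; (iii) $A$ is scattered if and only if for every subset $B\subseteq A$ there exists a finite subset $Y$ of $G$ lying in the closure (in $\mathcal{P}_G$) of $\{Bb^{ -1}: b\in B\}$.
   Context: Identify $\mathcal{P}_G$ with $\{0,1\}^G$ with the product topology, a $G$-space under $(A,g)\mapsto Ag$. For $X\in\mathcal{P}_G$: $[U]_X=\{g: Xg\in U\}$, $T(X)$ is the closure of $\{Xg:g\in G\}$, and $W(X)=\{Y\in T(X): [U]_X$ infinite for every neighbourhood $U$ of $Y\}$. $A$ is $n$-thin if for all distinct $g_0,\dots,g_n\in G$ the set $g_0A\cap\dots\cap g_nA$ is finite. $A$ is sparse if for every infinite $X\subseteq G$ there is finite $F\subseteq X$ with $\bigcap_{g\in F}gA$ finite. Identify $\beta G$ with the set of ultrafilters on $G$ with its usual semigroup extension of the multiplication ($gp=\{gP:P\in p\}$); $G^*$ is the set of free ultrafilters and for $X\subseteq G$, $X^*=\{p\in G^*: X\in p\}$. For $p\in G^*$, $\Delta_p(X)=X^*\cap Gp=\{gp: g\in G, X\in gp\}$. $A$ is scattered if for every infinite $X\subseteq A$ there is $p\in X^*$ with $\Delta_p(X)$ finite.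
   Formalization: In (iii), "every subset B ⊆ A" is taken as "every nonempty subset B ⊆ A": for B = ∅ the set {Bb⁻¹ : b ∈ B} and its closure are empty, so the literal condition fails for every A, although A = ∅ is scattered. -}

module Defs where

open import Level using (Level; _⊔_; suc)
open import Algebra.Bundles using (Group)
open import Data.Fin.Base using (Fin)
open import Data.List.Base using (List; length)
open import Data.List.Relation.Unary.All using (All)
import Data.List.Membership.Setoid as Membership
open import Data.Nat.Base using (ℕ; _≤_) renaming (suc to 1+)
open import Data.Product.Base using (_×_; _,_; ∃; ∃-syntax)
open import Data.Sum.Base using (_⊎_)
open import Function.Bundles using (_⇔_)
open import Function.Definitions using (Injective)
open import Relation.Binary.Bundles using (Setoid; Poset)
open import Relation.Binary.Definitions using (_Respects_)
open import Relation.Binary.PropositionalEquality.Core using (_≡_)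
open import Relation.Nullary.Negation.Core using (¬_)
open import Relation.Unary using (Pred; _∈_; _∉_; _⊆_; _≐_; Satisfiable)
open import Relation.Unary.Properties using (≐-refl; ≐-sym; ≐-trans)

private
  variable
    a b c ℓ ℓ₁ ℓ₂ p : Level

-- Zorn's lemma.  Together with Axiom.ExcludedMiddle it serves as an explicit
-- hypothesis standing for the classical background theory (ZFC).
-- The empty chain is allowed, so boundedness of chains makes P inhabited.

module _ (P : Poset c ℓ₁ ℓ₂) where
  open Poset P renaming (_≤_ to _⊑_)

  IsChain : Pred Carrier p → Set (c ⊔ ℓ₂ ⊔ p)
  IsChain C = ∀ {x y} → x ∈ C → y ∈ C → x ⊑ y ⊎ y ⊑ x

  UpperBound : Pred Carrier p → Carrier → Set (c ⊔ ℓ₂ ⊔ p)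
  UpperBound C u = ∀ {x} → x ∈ C → x ⊑ u

  Maximal : Carrier → Set (c ⊔ ℓ₂)
  Maximal m = ∀ {x} → m ⊑ x → x ⊑ m

ZornsLemma : ∀ c ℓ₁ ℓ₂ → Set (suc (c ⊔ ℓ₁ ⊔ ℓ₂))
ZornsLemma c ℓ₁ ℓ₂ =
  (P : Poset c ℓ₁ ℓ₂) →
  ((C : Pred (Poset.Carrier P) (c ⊔ ℓ₁ ⊔ ℓ₂)) → IsChain P C → ∃ (UpperBound P C)) →
  ∃ (Maximal P)

record Subset (S : Setoid a b) : Set (suc (a ⊔ b)) where
  constructor subset
  open Setoid S
  field
    ⟦_⟧  : Pred Carrier (a ⊔ b)
    resp : ⟦_⟧ Respects _≈_

open Subset public using (⟦_⟧)

𝒫 : Setoid a b → Setoid (suc (a ⊔ b)) (a ⊔ b)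
𝒫 S = record
  { Carrier       = Subset S
  ; _≈_           = λ X Y → ⟦ X ⟧ ≐ ⟦ Y ⟧
  ; isEquivalence = record { refl = ≐-refl ; sym = ≐-sym ; trans = ≐-trans }
  }

-- Cardinality is counted up to the setoid equality: |P| ≤ n means that P is
-- covered by a list of length at most n.

module _ (S : Setoid a b) where
  open Setoid S
  open Membership S using () renaming (_∈_ to _∈ₗ_)

  AtMost : ℕ → Pred Carrier p → Set (a ⊔ b ⊔ p)
  AtMost n P = ∃[ xs ] length xs ≤ n × (∀ {x} → x ∈ P → x ∈ₗ xs)

  Finite : Pred Carrier p → Set (a ⊔ b ⊔ p)
  Finite P = ∃[ n ] AtMost n P

  Infinite : Pred Carrier p → Set (a ⊔ b ⊔ p)
  Infinite P = ¬ Finite P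

-- The topology of 𝒫 S ≅ {0,1}^S: the sets of all Z agreeing with Y at
-- finitely many given coordinates form a neighbourhood base at Y.

module _ (S : Setoid a b) where
  open Setoid S

  AgreeOn : List Carrier → Subset S → Subset S → Set (a ⊔ b)
  AgreeOn F Y Z = All (λ x → x ∈ ⟦ Y ⟧ ⇔ x ∈ ⟦ Z ⟧) F

  Neighbourhood : Subset S → Subset (𝒫 S) → Set (suc (a ⊔ b))
  Neighbourhood Y N = ∃[ F ] AgreeOn F Y ⊆ ⟦ N ⟧

  Closure : Pred (Subset S) p → Pred (Subset S) (suc (suc (a ⊔ b)) ⊔ p)
  Closure 𝓕 Y = ∀ N → Neighbourhood Y N → ∃[ Z ] Z ∈ 𝓕 × Z ∈ ⟦ N ⟧

module _ (S : Setoid a b) where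
  open Setoid S

  infixr 7 _∩ₛ_

  _∩ₛ_ : Subset S → Subset S → Subset S
  X ∩ₛ Y = subset (λ x → x ∈ ⟦ X ⟧ × x ∈ ⟦ Y ⟧)
    (λ x≈y (x∈X , x∈Y) → Subset.resp X x≈y x∈X , Subset.resp Y x≈y x∈Y)

  ∁ₛ : Subset S → Subset S
  ∁ₛ X = subset (λ x → x ∉ ⟦ X ⟧) (λ x≈y x∉X y∈X → x∉X (Subset.resp X (sym x≈y) y∈X))

  record IsUltrafilter (p : Subset (𝒫 S)) : Set (suc (a ⊔ b)) where
    field
      whole    : ∀ {X} → (∀ x → x ∈ ⟦ X ⟧) → X ∈ ⟦ p ⟧
      nonempty : ∀ {X} → X ∈ ⟦ p ⟧ → Satisfiable ⟦ X ⟧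
      upward   : ∀ {X Y} → ⟦ X ⟧ ⊆ ⟦ Y ⟧ → X ∈ ⟦ p ⟧ → Y ∈ ⟦ p ⟧
      meet     : ∀ {X Y} → X ∈ ⟦ p ⟧ → Y ∈ ⟦ p ⟧ → (X ∩ₛ Y) ∈ ⟦ p ⟧
      ultra    : ∀ X → X ∈ ⟦ p ⟧ ⊎ ∁ₛ X ∈ ⟦ p ⟧

  record FreeUltrafilter : Set (suc (suc (a ⊔ b))) where
    field
      family        : Subset (𝒫 S)
      isUltrafilter : IsUltrafilter family
      free          : ∀ x → ¬ (∀ X → X ∈ ⟦ family ⟧ → x ∈ ⟦ X ⟧)

module GroupNotions (G : Group c ℓ) where
  open Group G

  SubsetG : Set (suc (c ⊔ ℓ))
  SubsetG = Subset setoid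

  infixl 8 _·ʳ_
  infixr 8 _·ˡ_

  _·ʳ_ : SubsetG → Carrier → SubsetG
  A ·ʳ g = subset (λ x → ∃[ y ] y ∈ ⟦ A ⟧ × x ≈ y ∙ g)
    (λ x≈z (y , y∈A , x≈yg) → y , y∈A , trans (sym x≈z) x≈yg)

  _·ˡ_ : Carrier → SubsetG → SubsetG
  g ·ˡ A = subset (λ x → ∃[ y ] y ∈ ⟦ A ⟧ × x ≈ g ∙ y)
    (λ x≈z (y , y∈A , x≈gy) → y , y∈A , trans (sym x≈z) x≈gy)

  [_]⟨_⟩ : Subset (𝒫 setoid) → SubsetG → Pred Carrier (suc (c ⊔ ℓ))
  [ N ]⟨ X ⟩ g = X ·ʳ g ∈ ⟦ N ⟧

  T : SubsetG → Pred SubsetG (suc (suc (c ⊔ ℓ)))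
  T X = Closure setoid (λ Z → ∃[ g ] ⟦ Z ⟧ ≐ ⟦ X ·ʳ g ⟧)

  W : SubsetG → Pred SubsetG (suc (suc (c ⊔ ℓ)))
  W X Y = Y ∈ T X × (∀ N → Neighbourhood setoid Y N → Infinite setoid [ N ]⟨ X ⟩)

  Thin : ℕ → SubsetG → Set (c ⊔ ℓ)
  Thin n A = (g : Fin (1+ n) → Carrier) → Injective _≡_ _≈_ g →
    Finite setoid (λ x → ∀ i → x ∈ ⟦ g i ·ˡ A ⟧)

  -- The intersection over the empty F is all of G.
  Sparse : SubsetG → Set (suc (c ⊔ ℓ))
  Sparse A = (X : SubsetG) → Infinite setoid ⟦ X ⟧ →
    ∃[ F ] All ⟦ X ⟧ F × Finite setoid (λ x → All (λ g → x ∈ ⟦ g ·ˡ A ⟧) F)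

  G* : Setoid (suc (suc (c ⊔ ℓ))) (suc (c ⊔ ℓ))
  G* = record
    { Carrier       = FreeUltrafilter setoid
    ; _≈_           = λ p q → ⟦ family p ⟧ ≐ ⟦ family q ⟧
    ; isEquivalence = record { refl = ≐-refl ; sym = ≐-sym ; trans = ≐-trans }
    }
    where open FreeUltrafilter

  open FreeUltrafilter using (family)

  infix 9 _*

  _* : SubsetG → Pred (FreeUltrafilter setoid) (suc (c ⊔ ℓ))
  (X *) p = X ∈ ⟦ family p ⟧

  translate : Carrier → FreeUltrafilter setoid → Pred SubsetG (suc (c ⊔ ℓ))
  translate g p X = ∃[ P ] P ∈ ⟦ family p ⟧ × ⟦ X ⟧ ≐ ⟦ g ·ˡ P ⟧

  Orbit : FreeUltrafilter setoid → Pred (FreeUltrafilter setoid) (suc (c ⊔ ℓ))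
  Orbit p q = ∃[ g ] ⟦ family q ⟧ ≐ translate g p

  Δ : FreeUltrafilter setoid → SubsetG → Pred (FreeUltrafilter setoid) (suc (c ⊔ ℓ))
  Δ p X q = q ∈ X * × q ∈ Orbit p

  Scattered : SubsetG → Set (suc (suc (c ⊔ ℓ)))
  Scattered A = (X : SubsetG) → ⟦ X ⟧ ⊆ ⟦ A ⟧ → Infinite setoid ⟦ X ⟧ →
    ∃[ p ] p ∈ X * × Finite G* (Δ p X)

  -- {B b⁻¹ : b ∈ B}
  Quotients : SubsetG → Pred SubsetG (c ⊔ ℓ)
  Quotients B Z = ∃[ b ] b ∈ ⟦ B ⟧ × ⟦ Z ⟧ ≐ ⟦ B ·ʳ (b ⁻¹) ⟧

{-# OPTIONS --safe #-}
-- For a free ultrafilter p put lim p A = {h : h⁻¹A ∈ p}, the limit of Ax⁻¹ as x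
-- tends to p.  It belongs to W(A), and conversely a finite subset F of a member of
-- W(A) lies in Ax⁻¹, that is x ∈ ⋂_{h ∈ F} h⁻¹A, for infinitely many x.  So (i) and
-- (ii) reduce to finding a free ultrafilter which contains gA for all given g, which
-- is possible if all finite intersections of these sets are infinite.
--
-- For (iii), lim p B = {h : B ∈ hp}, and G acts freely on its free ultrafilters, so
-- lim p B is finite if and only if Δ_p(B) is.  If B ∈ p, then lim p B is in the
-- closure of {Bb⁻¹ : b ∈ B}.  Conversely a finite Y in this closure, for infinite B,
-- is lim p B for some free p containing B: if only finitely many Bb⁻¹ agreed with Y
-- on F, then adding to F a point of Bb⁻¹ ∖ Y for each of these b would leave none.
module Submission where

open import Defs
open import Algebra.Bundles using (Group)
import Algebra.Properties.Group as GroupProperties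
open import Axiom.ExcludedMiddle using (ExcludedMiddle)
open import Data.Empty using (⊥-elim)
open import Data.Fin.Base using (Fin; zero; suc)
open import Data.Fin.Properties using (pigeonhole; <⇒≢)
open import Data.List.Base using (List; []; _∷_; _++_; map; tabulate)
import Data.List.Membership.Setoid as SetoidMembership
import Data.List.Membership.Setoid.Properties as Membershipₚ
import Data.List.Membership.Propositional as ListMembership
open import Data.List.Properties using (length-tabulate)
open import Data.List.Relation.Binary.Subset.Propositional using () renaming (_⊆_ to _⊆ₗ_)
open import Data.List.Relation.Unary.All as All using (All; []; _∷_)
open import Data.List.Relation.Unary.All.Properties as Allₚ using (anti-mono)
open import Data.List.Relation.Unary.Any as Any using (here; there)
import Data.List.Relation.Unary.Any.Properties as Anyₚ
open import Data.Nat.Base using (ℕ; _≤_; s≤s; s≤s⁻¹) renaming (suc to 1+)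
open import Data.Nat.Properties using (≤-refl; ≤-trans; ≤-reflexive; n≤1+n)
open import Data.Product.Base using (_×_; _,_; ∃; ∃-syntax; proj₁; proj₂)
open import Data.Sum.Base using (_⊎_; inj₁; inj₂)
open import Function.Base using (_∘_; id)
open import Function.Bundles using (_⇔_; mk⇔; Equivalence)
open import Function.Definitions using (Injective)
open import Level using (_⊔_; Lift; lift; lower) renaming (suc to lsuc)
open import Relation.Binary.Bundles using (Setoid; Poset)
import Relation.Binary.Construct.On as On
open import Relation.Binary.PropositionalEquality.Core as ≡ using (_≡_)
open import Relation.Nullary.Decidable using (True; toWitness; fromWitness; yes; no)
open import Relation.Nullary.Decidable.Core using (decidable-stable)
open import Relation.Nullary.Negation.Core using (¬_)
open import Relation.Unary using (Pred; _∈_; _∉_; _⊆_; _≐_; _∪_; U; Satisfiable)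
open import Relation.Unary.Properties using (≐-refl; ≐-sym; ≐-trans)
open import Relation.Unary.Relation.Binary.Subset using (⊆-poset)

open Equivalence using (to; from)

-- Classical propositions and universe levels.

module _ (em : ∀ {a} → ExcludedMiddle a) where

  -- The decision given by `em` yields a type `True` at the lowest level, which can be lifted to any
  -- other: excluded middle makes propositions impredicative.
  Resize : ∀ {p} q → Set p → Set q
  Resize q P = Lift q (True (em {P = P}))

  resize : ∀ {p q} {P : Set p} → P → Resize q P
  resize = lift ∘ fromWitness

  unresize : ∀ {p q} {P : Set p} → Resize q P → P
  unresize = toWitness ∘ lower

  -- Finiteness and cardinality up to setoid equality.

  module _ {a b} (S : Setoid a b) where
    open Setoid S
    open SetoidMembership S using () renaming (_∈_ to _∈ₗ_)

    finite : ∀ {p} {P : Pred Carrier p} xs → (∀ {x} → x ∈ P → x ∈ₗ xs) → Finite S P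
    finite xs cover = _ , xs , ≤-refl , cover

    Finite-⊆ : ∀ {p q} {P : Pred Carrier p} {Q : Pred Carrier q} → P ⊆ Q → Finite S Q → Finite S P
    Finite-⊆ P⊆Q (n , xs , len , cover) = n , xs , len , cover ∘ P⊆Q

    Finite-∪ : ∀ {p q} {P : Pred Carrier p} {Q : Pred Carrier q} →
      Finite S P → Finite S Q → Finite S (P ∪ Q)
    Finite-∪ (_ , xs , _ , coverP) (_ , ys , _ , coverQ) = finite (xs ++ ys) λ where
      (inj₁ x∈P) → Membershipₚ.∈-++⁺ˡ S (coverP x∈P)
      (inj₂ x∈Q) → Membershipₚ.∈-++⁺ʳ S xs (coverQ x∈Q)

    Infinite⇒Satisfiable : ∀ {p} {P : Pred Carrier p} → Infinite S P → Satisfiable P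
    Infinite⇒Satisfiable {P = P} inf with em {P = Satisfiable P}
    ... | yes P≢∅ = P≢∅
    ... | no  P≡∅ = ⊥-elim (inf (finite [] λ x∈P → ⊥-elim (P≡∅ (_ , x∈P))))

    -- Two of the points would be covered by the same entry of the list.
    Injection⇒¬AtMost : ∀ {p} {P : Pred Carrier p} {n} (g : Fin (1+ n) → Carrier) →
      Injective _≡_ _≈_ g → (∀ i → g i ∈ P) → ¬ AtMost S n P
    Injection⇒¬AtMost g inj g∈P (xs , len , cover)
      with i , j , i<j , eq ← pigeonhole (s≤s len) (λ i → Any.index (cover (g∈P i))) =
      <⇒≢ i<j (inj (Membershipₚ.index-injective S (cover (g∈P i)) (cover (g∈P j)) eq))

    -- Choose new points of `P` greedily; if the choice stops after `m` points, these cover `P`, and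
    -- `m ≤ n`.
    ¬AtMost⇒Injection : ∀ {p} {P : Pred Carrier p} {n} → ¬ AtMost S n P →
      ∃[ g ] Injective _≡_ _≈_ g × (∀ (i : Fin (1+ n)) → g i ∈ P)
    ¬AtMost⇒Injection {P = P} {n} large = go (1+ n) ≤-refl
      where
      go : ∀ m → m ≤ 1+ n → ∃[ g ] Injective _≡_ _≈_ g × (∀ (i : Fin m) → g i ∈ P)
      go ℕ.zero _ = (λ ()) , (λ { {()} }) , λ ()
      go (1+ m) m<1+n with g , inj , g∈P ← go m (≤-trans (n≤1+n m) m<1+n)
        | em {P = ∃[ x ] x ∈ P × (∀ i → ¬ x ≈ g i)}
      ... | yes (x , x∈P , x≉g) = g′ , inj′ , g′∈P
        where
        g′ : Fin (1+ m) → Carrier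
        g′ zero    = x
        g′ (suc i) = g i

        inj′ : Injective _≡_ _≈_ g′
        inj′ {zero}  {zero}  _  = ≡.refl
        inj′ {zero}  {suc j} eq = ⊥-elim (x≉g j eq)
        inj′ {suc i} {zero}  eq = ⊥-elim (x≉g i (sym eq))
        inj′ {suc i} {suc j} eq = ≡.cong suc (inj eq)

        g′∈P : ∀ i → g′ i ∈ P
        g′∈P zero    = x∈P
        g′∈P (suc i) = g∈P i
      ... | no none = ⊥-elim (large
        (tabulate g , ≤-trans (≤-reflexive (length-tabulate g)) (s≤s⁻¹ m<1+n) , λ {x} x∈P →
          decidable-stable em λ x∉g →
            none (x , x∈P , λ i x≈gi → x∉g (Anyₚ.tabulate⁺ i x≈gi))))

  -- Keep one preimage for each entry of the list covering `Q` that has one; by `inj` every other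
  -- preimage is equal to it.
  Finite-injection : ∀ {a b a′ b′ p q} (S : Setoid a b) (T : Setoid a′ b′)
    {P : Pred (Setoid.Carrier S) p} {Q : Pred (Setoid.Carrier T) q}
    (f : Setoid.Carrier S → Setoid.Carrier T) →
    (∀ {x} → x ∈ P → f x ∈ Q) →
    (∀ {x y} → Setoid._≈_ T (f x) (f y) → Setoid._≈_ S x y) →
    Finite T Q → Finite S P
  Finite-injection S T {P} f f∈Q inj (_ , ys , _ , coverQ) =
    let xs , cover = go ys in finite S xs (λ x∈P → cover x∈P (coverQ (f∈Q x∈P)))
    where
    module S = Setoid S
    module T = Setoid T
    open SetoidMembership S using () renaming (_∈_ to _∈ₛ_)
    open SetoidMembership T using () renaming (_∈_ to _∈ₜ_)

    go : ∀ ys → ∃[ xs ] (∀ {x} → x ∈ P → f x ∈ₜ ys → x ∈ₛ xs)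
    go [] = [] , λ _ ()
    go (y ∷ ys) with xs , cover ← go ys | em {P = ∃[ z ] f z T.≈ y}
    ... | yes (z , fz≈y) = z ∷ xs , λ where
      x∈P (here fx≈y)   → here (inj (T.trans fx≈y (T.sym fz≈y)))
      x∈P (there fx∈ys) → there (cover x∈P fx∈ys)
    ... | no none = xs , λ where
      x∈P (here fx≈y)   → ⊥-elim (none (_ , fx≈y))
      x∈P (there fx∈ys) → cover x∈P fx∈ys

  -- Maximal families of finite character.

  module _ (zorn : ∀ {a ℓ₁ ℓ₂} → ZornsLemma a ℓ₁ ℓ₂) where

    -- The Teichmüller–Tukey lemma.
    tukey : ∀ {a r} {A : Set a} (Q : Pred (List A) r) →
      (∀ {xs ys} → xs ⊆ₗ ys → Q ys → Q xs) → Q [] →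
      ∃[ M ] (∀ {xs} → All {p = a} M xs → Q xs) ×
             (∀ {x} → (∀ {xs} → All M xs → Q (x ∷ xs)) → x ∈ M)
    tukey {a} {r} {A} Q Q-⊆ Q[] =
      M , M-good , λ {x} ext →
        M-max {(M ∪ (_≡ x)) , extended ext} inj₁ (inj₂ ≡.refl)
      where
      Good : Set (lsuc a ⊔ r)
      Good = ∃[ M ] (∀ {xs} → All {p = a} M xs → Q xs)

      P : Poset (lsuc a ⊔ r) a a
      P = On.poset (⊆-poset A a) (proj₁ {B = λ M → ∀ {xs} → All M xs → Q xs})

      -- The union quantifies over `Good`, which lives above level `a`; resizing brings it back to
      -- the level of the predicates in `P`.
      ⋃ : Pred Good (lsuc a ⊔ r) → Pred A a
      ⋃ C x = Resize a (∃[ m ] m ∈ C × x ∈ proj₁ m)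

      -- Of two members of a chain the larger serves for both. The list is nonempty because an empty
      -- chain has no member to offer; `Q[]` settles the empty list.
      common : ∀ {C} → IsChain P C → ∀ {x xs} → All (⋃ C) (x ∷ xs) →
        ∃[ m ] m ∈ C × All (proj₁ m) (x ∷ xs)
      common chain (x∈ ∷ []) with m , m∈C , x∈m ← unresize x∈ = m , m∈C , x∈m ∷ []
      common chain (x∈ ∷ xs∈@(_ ∷ _))
        with m , m∈C , x∈m ← unresize x∈ | m′ , m′∈C , xs∈m′ ← common chain xs∈
        with chain m∈C m′∈C
      ... | inj₁ m⊆m′ = m′ , m′∈C , m⊆m′ x∈m ∷ xs∈m′
      ... | inj₂ m′⊆m = m , m∈C , x∈m ∷ All.map m′⊆m xs∈m′

      bound : ∀ C → IsChain P C → ∃ (UpperBound P C)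
      bound C chain = (⋃ C , good) , λ m∈C x∈m → resize (_ , m∈C , x∈m)
        where
        good : ∀ {xs} → All (⋃ C) xs → Q xs
        good [] = Q[]
        good xs∈@(_ ∷ _) with (_ , m-good) , _ , xs∈m ← common chain xs∈ = m-good xs∈m

      M : Pred A a
      M = proj₁ (proj₁ (zorn P bound))

      M-good : ∀ {xs} → All M xs → Q xs
      M-good = proj₂ (proj₁ (zorn P bound))

      M-max : Maximal P (M , M-good)
      M-max {m} = proj₂ (zorn P bound) {m}

      skip : ∀ {x y : A} {ys} → (x ∷ ys) ⊆ₗ (x ∷ y ∷ ys)
      skip (here eq)    = here eq
      skip (there z∈ys) = there (there z∈ys)

      -- Collects the occurrences of `x` into one head, so that a hypothesis on lists `x ∷ ys` with
      -- `ys` from `M` applies.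
      split : ∀ {x xs} → All (M ∪ (_≡ x)) xs → ∃[ ys ] All M ys × xs ⊆ₗ (x ∷ ys)
      split [] = [] , [] , λ ()
      split (y∈ ∷ xs∈) with ys , ys∈M , sub ← split xs∈ | y∈
      ... | inj₁ y∈M = _ ∷ ys , y∈M ∷ ys∈M , λ where
        (here eq)   → there (here eq)
        (there z∈xs) → skip (sub z∈xs)
      ... | inj₂ ≡.refl = ys , ys∈M , λ where
        (here eq)   → here eq
        (there z∈xs) → sub z∈xs

      extended : ∀ {x} → (∀ {xs} → All M xs → Q (x ∷ xs)) → ∀ {xs} → All (M ∪ (_≡ x)) xs → Q xs
      extended ext xs∈ with _ , ys∈M , sub ← split xs∈ = Q-⊆ sub (ext ys∈M)

    -- Free ultrafilters on a setoid.

    module _ {a b} (S : Setoid a b) where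
      open Setoid S
      open FreeUltrafilter using (family)

      ⁅_⁆ : Carrier → Subset S
      ⁅ x ⁆ = subset (λ y → Lift a (y ≈ x)) (λ y≈z (lift y≈x) → lift (trans (sym y≈z) y≈x))

      ⁅⁆-finite : ∀ x → Finite S ⟦ ⁅ x ⁆ ⟧
      ⁅⁆-finite x = finite S (x ∷ []) (here ∘ lower)

      -- Take a maximal family whose finite meets, also with finitely many `R j`, are infinite.
      -- Asking for infinite rather than nonempty meets makes the ultrafilter free.
      ∃-freeUltrafilter : ∀ {j} {J : Set j} (R : J → Subset S) →
        (∀ js → Infinite S (λ x → All (λ j → x ∈ ⟦ R j ⟧) js)) →
        ∃[ p ] (∀ j → R j ∈ ⟦ family p ⟧)
      ∃-freeUltrafilter {J = J} R R-inf = p , R∈M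
        where
        Meet : List (Subset S) → List J → Pred Carrier _
        Meet Xs js x = All (λ X → x ∈ ⟦ X ⟧) Xs × All (λ j → x ∈ ⟦ R j ⟧) js

        maximal = tukey (λ Xs → ∀ js → Infinite S (Meet Xs js))
          (λ Xs⊆Ys inf js → inf js ∘ Finite-⊆ S λ (x∈Ys , x∈js) → anti-mono Xs⊆Ys x∈Ys , x∈js)
          (λ js → R-inf js ∘ Finite-⊆ S ([] ,_))

        M : Pred (Subset S) _
        M = proj₁ maximal

        M-inf : ∀ {Xs} → All M Xs → ∀ js → Infinite S (Meet Xs js)
        M-inf = proj₁ (proj₂ maximal)

        M-max : ∀ {X} → (∀ {Xs} → All M Xs → ∀ js → Infinite S (Meet (X ∷ Xs) js)) → X ∈ M
        M-max = proj₂ (proj₂ maximal)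

        R∈M : ∀ j → R j ∈ M
        -- `R j` can be moved into the list `js`, over which the property quantifies, so adding it
        -- to `M` keeps the meets infinite.
        R∈M j = M-max λ Xs∈M js → M-inf Xs∈M (j ∷ js) ∘
          Finite-⊆ S λ { (x∈Xs , x∈j ∷ x∈js) → x∈j ∷ x∈Xs , x∈js }

        -- A meet with `X` contains the meet with all of `Xs`, which is infinite. The lists of
        -- length 0, 1 and 2 give `whole`, `upward` and `meet`.
        closed : ∀ {Xs X} → All M Xs → (∀ {x} → All (λ X → x ∈ ⟦ X ⟧) Xs → x ∈ ⟦ X ⟧) → X ∈ M
        closed {Xs} Xs∈M ⋂⊆X = M-max λ Ys∈M js → M-inf (Allₚ.++⁺ Xs∈M Ys∈M) js ∘
          Finite-⊆ S λ (x∈ , x∈js) →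
            ⋂⊆X (Allₚ.++⁻ˡ Xs x∈) ∷ Allₚ.++⁻ʳ Xs x∈ , x∈js

        ultra : ∀ X → X ∈ M ⊎ ∁ₛ S X ∈ M
        ultra X with em {P = X ∈ M}
        ... | yes X∈M = inj₁ X∈M
        -- If both `X` and its complement had a finite meet with members of `M`, joining the two
        -- lists would give a finite meet without either of them.
        ... | no  X∉M = inj₂ (M-max λ {Ys} Ys∈M js fin₁ →
          X∉M (M-max λ Zs∈M ks fin₂ →
            M-inf (Allₚ.++⁺ Ys∈M Zs∈M) (js ++ ks) (Finite-⊆ S
              (λ {x} (x∈ , x∈js++ks) → case-on x
                (Allₚ.++⁻ˡ Ys x∈) (Allₚ.++⁻ʳ Ys x∈) (Allₚ.++⁻ˡ js x∈js++ks) (Allₚ.++⁻ʳ js x∈js++ks))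
              (Finite-∪ S fin₁ fin₂))))
          where
          case-on : ∀ x {Ys Zs js ks} → All (λ X → x ∈ ⟦ X ⟧) Ys → All (λ X → x ∈ ⟦ X ⟧) Zs →
            All (λ j → x ∈ ⟦ R j ⟧) js → All (λ j → x ∈ ⟦ R j ⟧) ks →
            x ∈ Meet (∁ₛ S X ∷ Ys) js ∪ Meet (X ∷ Zs) ks
          case-on x ys zs js ks with em {P = x ∈ ⟦ X ⟧}
          ... | yes x∈X = inj₂ (x∈X ∷ zs , ks)
          ... | no  x∉X = inj₁ (x∉X ∷ ys , js)

        p : FreeUltrafilter S
        p = record
          { family        = subset M λ X≐Y X∈M → closed (X∈M ∷ []) λ { (x∈X ∷ []) → proj₁ X≐Y x∈X }
          ; isUltrafilter = record
            { whole    = λ total → closed [] λ _ → total _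
            ; nonempty = λ X∈M → Infinite⇒Satisfiable S
                (M-inf (X∈M ∷ []) [] ∘ Finite-⊆ S λ { (x∈X ∷ [] , _) → x∈X })
            ; upward   = λ X⊆Y X∈M → closed (X∈M ∷ []) λ { (x∈X ∷ []) → X⊆Y x∈X }
            ; meet     = λ X∈M Y∈M → closed (X∈M ∷ Y∈M ∷ []) λ { (x∈X ∷ x∈Y ∷ []) → x∈X , x∈Y }
            ; ultra    = ultra
            }
          ; free          = free
          }
          where
          free : ∀ x → ¬ (∀ X → X ∈ M → x ∈ ⟦ X ⟧)
          free x fixed with ultra ⁅ x ⁆
          ... | inj₁ x∈M  = M-inf (x∈M ∷ []) [] (Finite-⊆ S (λ { (y∈x ∷ [] , _) → y∈x }) (⁅⁆-finite x))
          ... | inj₂ ∁x∈M = fixed _ ∁x∈M (lift refl)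

      module _ (p : FreeUltrafilter S) where
        open FreeUltrafilter p hiding (family)
        open IsUltrafilter isUltrafilter

        private
          _∈ᵘ : Subset S → Set _
          X ∈ᵘ = X ∈ ⟦ family p ⟧

        disjoint : ∀ {X Y} → X ∈ᵘ → Y ∈ᵘ → ¬ (∀ {x} → x ∈ ⟦ X ⟧ → x ∉ ⟦ Y ⟧)
        disjoint X∈p Y∈p X∩Y≡∅ with _ , x∈X , x∈Y ← nonempty (meet X∈p Y∈p) = X∩Y≡∅ x∈X x∈Y

        ∉⇒∁∈ : ∀ X → ¬ X ∈ᵘ → ∁ₛ S X ∈ᵘ
        ∉⇒∁∈ X X∉p with ultra X
        ... | inj₁ X∈p  = ⊥-elim (X∉p X∈p)
        ... | inj₂ ∁X∈p = ∁X∈p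

        -- The induction varies the target: after removing `j` it becomes the implication from `R j`
        -- to `X`.
        meet-All : ∀ {j} {J : Set j} (R : J → Subset S) → (∀ j → R j ∈ᵘ) → ∀ js {X} →
          (∀ {x} → All (λ j → x ∈ ⟦ R j ⟧) js → x ∈ ⟦ X ⟧) → X ∈ᵘ
        meet-All R R∈p [] ⋂⊆X = whole (λ _ → ⋂⊆X [])
        meet-All R R∈p (j ∷ js) {X} ⋂⊆X = upward (λ (x∈Rj , imp) → imp x∈Rj)
          (meet (R∈p j) (meet-All R R∈p js {Rj⇒X} λ x∈js x∈Rj → ⋂⊆X (x∈Rj ∷ x∈js)))
          where
          Rj⇒X : Subset S
          Rj⇒X = subset (λ x → x ∈ ⟦ R j ⟧ → x ∈ ⟦ X ⟧)
            (λ x≈y imp y∈ → Subset.resp X x≈y (imp (Subset.resp (R j) (sym x≈y) y∈)))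

        -- Freeness puts the complement of each point in `p`; a finite `X` would miss a finite
        -- intersection of these.
        ∈⇒Infinite : ∀ {X} → X ∈ᵘ → Infinite S ⟦ X ⟧
        ∈⇒Infinite {X} X∈p (_ , xs , _ , cover) = disjoint X∈p
          (meet-All (λ x → ∁ₛ S ⁅ x ⁆) ∁⁅⁆∈p xs {∁ₛ S X}
            λ x∉xs x∈X → Allₚ.All¬⇒¬Any x∉xs (Any.map lift (cover x∈X)))
          (λ x∈X x∉X → x∉X x∈X)
          where
          ∁⁅⁆∈p : ∀ x → ∁ₛ S ⁅ x ⁆ ∈ᵘ
          ∁⁅⁆∈p x = ∉⇒∁∈ ⁅ x ⁆ λ x∈p → free x λ Y Y∈p →
            let z , lift z≈x , z∈Y = nonempty (meet x∈p Y∈p) in Subset.resp Y z≈x z∈Y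

      basic : List Carrier → Subset S → Subset (𝒫 S)
      basic F Y = subset (λ Z → Lift _ (AgreeOn S F Y Z))
        (λ Z≐Z′ (lift agree) → lift (All.map
          (λ e → mk⇔ (proj₁ Z≐Z′ ∘ to e) (from e ∘ proj₂ Z≐Z′)) agree))

      basic-neighbourhood : ∀ F Y → Neighbourhood S Y (basic F Y)
      basic-neighbourhood F Y = F , lift

    -- The action of the group on its free ultrafilters.

    module _ {c ℓ} (G : Group c ℓ) where
      open Group G
      open GroupNotions G
      open GroupProperties G
      open FreeUltrafilter using (family)

      infixr 7 _⊳_ _•_

      -- g⁻¹X (not gX), as the preimage of X.
      _⊳_ : Carrier → SubsetG → SubsetG
      g ⊳ X = subset (λ x → g ∙ x ∈ ⟦ X ⟧) (λ x≈y → Subset.resp X (∙-congˡ x≈y))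

      ∈-·ʳ⁻¹ : ∀ {h} B x → h ∈ ⟦ B ·ʳ (x ⁻¹) ⟧ ⇔ h ∙ x ∈ ⟦ B ⟧
      ∈-·ʳ⁻¹ {h} B x = mk⇔
        (λ (y , y∈B , h≈yx⁻¹) → Subset.resp B
          (sym (trans (∙-congʳ h≈yx⁻¹) (//-rightDividesˡ x y))) y∈B)
        (λ hx∈B → h ∙ x , hx∈B , sym (//-rightDividesʳ x h))

      ∈-·ˡ : ∀ {x} g A → x ∈ ⟦ g ·ˡ A ⟧ ⇔ g ⁻¹ ∙ x ∈ ⟦ A ⟧
      ∈-·ˡ {x} g A = mk⇔
        (λ (y , y∈A , x≈gy) → Subset.resp A
          (sym (trans (∙-congˡ x≈gy) (\\-leftDividesʳ g y))) y∈A)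
        (λ g⁻¹x∈A → g ⁻¹ ∙ x , g⁻¹x∈A , sym (\\-leftDividesˡ g x))

      ∈-⁻¹·ˡ : ∀ {x} h A → x ∈ ⟦ (h ⁻¹) ·ˡ A ⟧ ⇔ h ∙ x ∈ ⟦ A ⟧
      ∈-⁻¹·ˡ {x} h A = mk⇔
        (Subset.resp A h⁻¹⁻¹x≈hx ∘ to (∈-·ˡ (h ⁻¹) A))
        (from (∈-·ˡ (h ⁻¹) A) ∘ Subset.resp A (sym h⁻¹⁻¹x≈hx))
        where
        h⁻¹⁻¹x≈hx = ∙-congʳ (⁻¹-involutive h)

      Finite-⁻¹ : ∀ {p} {P : Pred Carrier p} → Finite setoid P → Finite setoid (λ x → x ⁻¹ ∈ P)
      Finite-⁻¹ = Finite-injection setoid setoid _⁻¹ id ⁻¹-injective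

      -- The translate gp, with membership tested by taking the preimage under g, so that no `P`
      -- with X = gP has to be produced.
      _•_ : Carrier → FreeUltrafilter setoid → FreeUltrafilter setoid
      g • p = record
        { family        = subset (λ X → g ⊳ X ∈ ⟦ family p ⟧) (λ X≐Y → upward (proj₁ X≐Y))
        ; isUltrafilter = record
          { whole    = λ total → whole (λ x → total (g ∙ x))
          ; nonempty = λ gX∈p → let x , gx∈X = nonempty gX∈p in g ∙ x , gx∈X
          ; upward   = λ X⊆Y → upward X⊆Y
          ; meet     = meet
          ; ultra    = λ X → ultra (g ⊳ X)
          }
        ; free          = λ x fixed → free (g ⁻¹ ∙ x) λ X X∈p →
            fixed (g ⁻¹ ⊳ X) (upward (λ {y} → Subset.resp X (sym (\\-leftDividesʳ g y))) X∈p)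
        }
        where
        open FreeUltrafilter p hiding (family)
        open IsUltrafilter isUltrafilter

      module _ (p : FreeUltrafilter setoid) where
        open FreeUltrafilter p using (isUltrafilter)
        open IsUltrafilter isUltrafilter

        •-translate : ∀ g → ⟦ family (g • p) ⟧ ≐ translate g p
        •-translate g =
          (λ {X} gX∈p → g ⊳ X , gX∈p ,
            (λ {x} x∈X → from (∈-·ˡ g (g ⊳ X)) (Subset.resp X (sym (\\-leftDividesˡ g x)) x∈X)) ,
            λ (y , gy∈X , x≈gy) → Subset.resp X (sym x≈gy) gy∈X) ,
          λ (P , P∈p , X≐gP) → upward (λ y∈P → proj₂ X≐gP (_ , y∈P , refl)) P∈p

        •-cong : ∀ {g h} → g ≈ h → ⟦ family (g • p) ⟧ ≐ ⟦ family (h • p) ⟧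
        •-cong g≈h =
          (λ {X} → upward (Subset.resp X (∙-congʳ g≈h))) ,
          (λ {X} → upward (Subset.resp X (∙-congʳ (sym g≈h))))

        -- A maximal M disjoint from kM satisfies G = M ∪ kM ∪ k⁻¹M if k ≉ ε.
        stabiliser-trivial : ∀ k → (∀ {X} → X ∈ ⟦ family p ⟧ → k ⊳ X ∈ ⟦ family p ⟧) → k ≈ ε
        stabiliser-trivial k stable = decidable-stable em λ k≉ε →
          -- If `k` were not `ε`, three members of `p` would have empty meet: by `covers`, no point
          -- `x` has all of `x`, `k ∙ x` and `k ⁻¹ ∙ x` outside `N`.
          disjoint setoid p
            (meet ∁N∈p (stable ∁N∈p)) ∁k⁻¹N∈p
            λ (x∉N , kx∉N) k⁻¹x∉N → x∉N (covers k≉ε kx∉N k⁻¹x∉N)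
          where
          maximal = tukey
            (λ xs → ∀ {x y} → x ListMembership.∈ xs → y ListMembership.∈ xs → ¬ x ≈ k ∙ y)
            (λ xs⊆ys apart x∈ y∈ → apart (xs⊆ys x∈) (xs⊆ys y∈)) (λ ())

          M : Pred Carrier c
          M = proj₁ maximal

          apart : ∀ {x y} → x ∈ M → y ∈ M → ¬ x ≈ k ∙ y
          apart x∈M y∈M = proj₁ (proj₂ maximal) (x∈M ∷ y∈M ∷ []) (here ≡.refl) (there (here ≡.refl))

          -- The saturation of `M`, which comes from lists under propositional equality and carries
          -- no proof that it respects `_≈_`.
          N : SubsetG
          N = subset (λ x → ∃[ y ] y ∈ M × x ≈ y)
            (λ x≈z (y , y∈M , x≈y) → y , y∈M , trans (sym x≈z) x≈y)

          -- By maximality it suffices that `x` can join `M`. The three hypotheses exclude a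
          -- conflict of `x` with itself and, in either order, with a point of `M`.
          covers : ¬ k ≈ ε → ∀ {x} → k ∙ x ∉ ⟦ N ⟧ → k ⁻¹ ∙ x ∉ ⟦ N ⟧ → x ∈ ⟦ N ⟧
          covers k≉ε {x} kx∉N k⁻¹x∉N = x , proj₂ (proj₂ maximal) ext , refl
            where
            x≉kx : ¬ x ≈ k ∙ x
            x≉kx x≈kx = k≉ε (identityˡ-unique k x (sym x≈kx))

            ext : ∀ {xs} → All M xs → ∀ {y z} →
              y ListMembership.∈ x ∷ xs → z ListMembership.∈ x ∷ xs → ¬ y ≈ k ∙ z
            ext xs∈M (here ≡.refl) (here ≡.refl) = x≉kx
            ext xs∈M (here ≡.refl) (there z∈)    = λ x≈kz →
              k⁻¹x∉N (_ , All.lookup xs∈M z∈ , trans (∙-congˡ x≈kz) (\\-leftDividesʳ k _))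
            ext xs∈M (there y∈)    (here ≡.refl) = λ y≈kx →
              kx∉N (_ , All.lookup xs∈M y∈ , sym y≈kx)
            ext xs∈M (there y∈)    (there z∈)    = apart (All.lookup xs∈M y∈) (All.lookup xs∈M z∈)

          N∉p : N ∉ ⟦ family p ⟧
          N∉p N∈p = disjoint setoid p N∈p (stable N∈p)
            λ (y , y∈M , x≈y) (z , z∈M , kx≈z) →
              apart z∈M y∈M (trans (sym kx≈z) (∙-congˡ x≈y))

          ∁N∈p : ∁ₛ setoid N ∈ ⟦ family p ⟧
          ∁N∈p = ∉⇒∁∈ setoid p N N∉p

          ∁k⁻¹N∈p : ∁ₛ setoid (k ⁻¹ ⊳ N) ∈ ⟦ family p ⟧
          -- `stable` works in one direction only, but applied to this set it returns `N`.
          ∁k⁻¹N∈p = ∉⇒∁∈ setoid p (k ⁻¹ ⊳ N) λ k⁻¹N∈p → N∉p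
            (upward (λ {x} → Subset.resp N (\\-leftDividesʳ k x)) (stable k⁻¹N∈p))

        -- Equal translates make `h ⁻¹ ∙ g` stabilise `p`.
        •-injective : ∀ {g h} → ⟦ family (g • p) ⟧ ≐ ⟦ family (h • p) ⟧ → g ≈ h
        •-injective {g} {h} gp≐hp = trans (inverseʳ-unique (h ⁻¹) g h⁻¹g≈ε) (⁻¹-involutive h)
          where
          h⁻¹g≈ε : h ⁻¹ ∙ g ≈ ε
          h⁻¹g≈ε = stabiliser-trivial (h ⁻¹ ∙ g) λ {X} X∈p →
            upward (λ {x} → Subset.resp X (sym (assoc (h ⁻¹) g x)))
              (proj₂ gp≐hp {h ⁻¹ ⊳ X}
                (upward (λ {x} → Subset.resp X (sym (\\-leftDividesʳ h x))) X∈p))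

        -- Limits along an ultrafilter.

        lim : SubsetG → SubsetG
        -- Membership in `p` lives one universe above the predicates of `SubsetG`, hence the
        -- resizing.
        lim B = subset (λ h → Resize (c ⊔ ℓ) (h ⊳ B ∈ ⟦ family p ⟧))
          (λ h≈k h∈ → resize (proj₁ (•-cong h≈k) {B} (unresize h∈)))

      -- The points x for which Bx⁻¹ is in the basic neighbourhood of `Y` given by `F`. That Bx⁻¹
      -- tends to `Y` along p means that these sets belong to p.
      Agreeing : List Carrier → SubsetG → SubsetG → SubsetG
      Agreeing F Y B = subset (λ x → All (λ h → h ∈ ⟦ Y ⟧ ⇔ h ∙ x ∈ ⟦ B ⟧) F)
        (λ x≈y → All.map (λ e → mk⇔
          (Subset.resp B (∙-congˡ x≈y) ∘ to e)
          (from e ∘ Subset.resp B (∙-congˡ (sym x≈y)))))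

      Agreeing⇒AgreeOn : ∀ {F x} Y B → x ∈ ⟦ Agreeing F Y B ⟧ → AgreeOn setoid F Y (B ·ʳ (x ⁻¹))
      Agreeing⇒AgreeOn Y B = All.map λ e →
        mk⇔ (from (∈-·ʳ⁻¹ B _) ∘ to e) (from e ∘ to (∈-·ʳ⁻¹ B _))

      module _ (p : FreeUltrafilter setoid) (B : SubsetG) where
        open FreeUltrafilter p using (isUltrafilter)
        open IsUltrafilter isUltrafilter

        -- Agreement on `F` is a finite intersection of agreements at single points `h`, where
        -- `h ⊳ B` or its complement belongs to `p`.
        Agreeing-lim : ∀ F → Agreeing F (lim p B) B ∈ ⟦ family p ⟧
        Agreeing-lim F = meet-All setoid p (λ h → Agreeing (h ∷ []) (lim p B) B) agree F
          (All.map All.head)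
          where
          agree : ∀ h → Agreeing (h ∷ []) (lim p B) B ∈ ⟦ family p ⟧
          agree h with em {P = h ⊳ B ∈ ⟦ family p ⟧}
          ... | yes hB∈p = upward (λ hx∈B → mk⇔ (λ _ → hx∈B) (λ _ → resize hB∈p) ∷ []) hB∈p
          ... | no  hB∉p = upward
            (λ hx∉B → mk⇔ (⊥-elim ∘ hB∉p ∘ unresize) (⊥-elim ∘ hx∉B) ∷ []) (∉⇒∁∈ setoid p (h ⊳ B) hB∉p)

        lim∈W : lim p B ∈ W B
        lim∈W = (λ N nbhd → let g , Bg∈N = Infinite⇒Satisfiable setoid (infinite N nbhd)
                            in B ·ʳ g , (g , ≐-refl) , Bg∈N) ,
                infinite
          where
          infinite : ∀ N → Neighbourhood setoid (lim p B) N → Infinite setoid [ N ]⟨ B ⟩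
          -- Otherwise the inverses of the finitely many translating elements would cover a member
          -- of `p`.
          infinite N (F , agree⊆N) fin = ∈⇒Infinite setoid p (Agreeing-lim F)
            (Finite-⊆ setoid (agree⊆N ∘ Agreeing⇒AgreeOn (lim p B) B) (Finite-⁻¹ fin))

        lim∈Closure : B ∈ ⟦ family p ⟧ → lim p B ∈ Closure setoid (Quotients B)
        lim∈Closure B∈p N (F , agree⊆N) with x , x∈B , agree ← nonempty (meet B∈p (Agreeing-lim F)) =
          B ·ʳ (x ⁻¹) , (x , x∈B , ≐-refl) , agree⊆N (Agreeing⇒AgreeOn (lim p B) B agree)

        Finite-lim : Finite G* (Δ p B) → Finite setoid ⟦ lim p B ⟧
        Finite-lim = Finite-injection setoid G* (_• p)
          (λ h∈ → unresize h∈ , _ , •-translate p _) (•-injective p)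

      -- If gp contains `X`, a point common to `g ⊳ X` and the agreement set at g shows that g is in
      -- `Y`. So only translates of `p` by points of `Y` occur.
      Finite-Δ : ∀ p X Y → Finite setoid ⟦ Y ⟧ →
        (∀ h → Agreeing (h ∷ []) Y X ∈ ⟦ family p ⟧) → Finite G* (Δ p X)
      Finite-Δ p X Y (_ , ys , _ , cover) p-lim = finite G* (map (_• p) ys) λ {q} → cover-Δ {q}
        where
        open FreeUltrafilter p using (isUltrafilter)
        open IsUltrafilter isUltrafilter
        open SetoidMembership G* using () renaming (_∈_ to _∈*_)

        ∈-limit : ∀ {g} → g ⊳ X ∈ ⟦ family p ⟧ → g ∈ ⟦ Y ⟧
        ∈-limit {g} gX∈p with x , gx∈X , e ∷ [] ← nonempty (meet {g ⊳ X} gX∈p (p-lim g)) = from e gx∈X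

        cover-Δ : ∀ {q} → Δ p X q → q ∈* map (_• p) ys
        cover-Δ {q} (X∈q , g , q≐gp) = Anyₚ.map⁺ (Any.map
          (λ {y} g≈y → ≐-trans q≐gp (≐-trans (≐-sym (•-translate p g)) (•-cong p g≈y)))
          (cover (∈-limit (proj₂ (•-translate p g) {X} (proj₁ q≐gp {X} X∈q)))))

      -- Infinitely many Ag lie in the neighbourhood of `Y` given by `F`; the points sought are the
      -- inverses of these g.
      W⇒Infinite : ∀ {A Y F} → Y ∈ W A → All ⟦ Y ⟧ F →
        Infinite setoid (λ x → All (λ h → h ∙ x ∈ ⟦ A ⟧) F)
      W⇒Infinite {A} {Y} {F} (_ , infinite) F⊆Y fin =
        infinite (basic setoid F Y) (basic-neighbourhood setoid F Y)
          (Finite-⊆ setoid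
            (λ {g} (lift agree) → All.zipWith
              (λ (h∈Y , e) → to (∈-·ʳ⁻¹ A (g ⁻¹)) (cancel (to e h∈Y))) (F⊆Y , agree))
            (Finite-⁻¹ fin))
        where
        cancel : ∀ {g h} → h ∈ ⟦ A ·ʳ g ⟧ → h ∈ ⟦ A ·ʳ (g ⁻¹ ⁻¹) ⟧
        cancel (y , y∈A , h≈yg) = y , y∈A , trans h≈yg (∙-congˡ (sym (⁻¹-involutive _)))

      ·ˡ⇒∈lim : ∀ {p g A} → g ·ˡ A ∈ ⟦ family p ⟧ → g ⁻¹ ∈ ⟦ lim p A ⟧
      ·ˡ⇒∈lim {p} {g} {A} gA∈p = resize (upward (to (∈-·ˡ g A)) gA∈p)
        where
        open FreeUltrafilter p using (isUltrafilter)
        open IsUltrafilter isUltrafilter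

      -- Thin and sparse sets.

      thin⇔ : ∀ n A → Thin n A ⇔ (∀ Y → Y ∈ W A → AtMost setoid n ⟦ Y ⟧)
      thin⇔ n A = mk⇔ thin⇒ ⇒thin
        where
        thin⇒ : Thin n A → ∀ Y → Y ∈ W A → AtMost setoid n ⟦ Y ⟧
        thin⇒ thin Y Y∈W = decidable-stable em λ large →
          let y , inj , y∈Y = ¬AtMost⇒Injection setoid large in
          W⇒Infinite {A} {Y} Y∈W (Allₚ.tabulate⁺ y∈Y)
            (Finite-⊆ setoid (λ yx∈A i → from (∈-⁻¹·ˡ (y i) A) (Allₚ.tabulate⁻ {f = y} yx∈A i))
              (thin (_⁻¹ ∘ y) (inj ∘ ⁻¹-injective)))

        ⇒thin : (∀ Y → Y ∈ W A → AtMost setoid n ⟦ Y ⟧) → Thin n A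
        ⇒thin small g inj = decidable-stable em λ infinite →
          let p , gA∈p = ∃-freeUltrafilter setoid (λ i → g i ·ˡ A)
                -- Each partial intersection contains the full one, which is assumed infinite.
                (λ is → infinite ∘ Finite-⊆ setoid (λ x∈gA → All.universal x∈gA is))
          in Injection⇒¬AtMost setoid (_⁻¹ ∘ g) (inj ∘ ⁻¹-injective)
               (λ i → ·ˡ⇒∈lim {p} {g i} {A} (gA∈p i)) (small (lim p A) (lim∈W p A))

      sparse⇔ : ∀ A → Sparse A ⇔ (∀ Y → Y ∈ W A → Finite setoid ⟦ Y ⟧)
      sparse⇔ A = mk⇔ sparse⇒ ⇒sparse
        where
        -- Sparseness intersects sets gA, whereas a point h of `Y` contributes h⁻¹A.
        _⁻¹ˢ : SubsetG → SubsetG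
        Y ⁻¹ˢ = subset (λ x → x ⁻¹ ∈ ⟦ Y ⟧) (λ x≈y → Subset.resp Y (⁻¹-cong x≈y))

        Finite-⁻¹ˢ : ∀ Y → Finite setoid ⟦ Y ⁻¹ˢ ⟧ → Finite setoid ⟦ Y ⟧
        Finite-⁻¹ˢ Y = Finite-injection setoid setoid _⁻¹
          (λ {x} → Subset.resp Y (sym (⁻¹-involutive x))) ⁻¹-injective

        sparse⇒ : Sparse A → ∀ Y → Y ∈ W A → Finite setoid ⟦ Y ⟧
        sparse⇒ sparse Y Y∈W = decidable-stable em λ infinite →
          let F , F⊆Y⁻¹ , fin = sparse (Y ⁻¹ˢ) (infinite ∘ Finite-⁻¹ˢ Y) in
          W⇒Infinite {A} {Y} Y∈W (Allₚ.map⁺ F⊆Y⁻¹)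
            (Finite-⊆ setoid (λ gx∈A → All.map (λ {g} → from (∈-·ˡ g A)) (Allₚ.map⁻ gx∈A)) fin)

        ⇒sparse : (∀ Y → Y ∈ W A → Finite setoid ⟦ Y ⟧) → Sparse A
        ⇒sparse small X X-infinite = decidable-stable em λ ¬sparse →
          -- All points of `X` serve as indices at once: a finite intersection over some of them
          -- would witness sparseness for `X`.
          let p , gA∈p = ∃-freeUltrafilter setoid {J = ∃ ⟦ X ⟧} (λ (g , _) → g ·ˡ A)
                (λ gs fin → ¬sparse (map proj₁ gs , Allₚ.map⁺ (All.universal proj₂ gs) ,
                  Finite-⊆ setoid Allₚ.map⁻ fin))
          in X-infinite (Finite-⊆ setoid
               (λ {g} g∈X → ·ˡ⇒∈lim {p} {g} {A} (gA∈p (g , g∈X)))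
               (Finite-⁻¹ (small (lim p A) (lim∈W p A))))

      -- Scattered sets.

      finite-limit⇒ultrafilter : ∀ X Y → Infinite setoid ⟦ X ⟧ → Finite setoid ⟦ Y ⟧ →
        Y ∈ Closure setoid (Quotients X) →
        ∃[ p ] (∀ h → X ∈ ⟦ family p ⟧ × Agreeing (h ∷ []) Y X ∈ ⟦ family p ⟧)
      finite-limit⇒ultrafilter X Y X-infinite Y-finite Y∈cl =
        p , λ h → upward proj₁ (R∈p h) , upward proj₂ (R∈p h)
        where
        -- `X` is part of every `R h`, so one family forces both membership of `X` and convergence
        -- to `Y`.
        R : Carrier → SubsetG
        R h = _∩ₛ_ setoid X (Agreeing (h ∷ []) Y X)

        -- Xx⁻¹ is as infinite as `X`, so it does not fit into the finite `Y`.
        escape : ∀ x → ∃[ h ] h ∙ x ∈ ⟦ X ⟧ × h ∉ ⟦ Y ⟧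
        escape x = decidable-stable em λ none → X-infinite
          (Finite-injection setoid setoid (_∙ x ⁻¹)
            (λ {y} y∈X → decidable-stable em λ yx⁻¹∉Y →
              none (_ , Subset.resp X (sym (//-rightDividesˡ x y)) y∈X , yx⁻¹∉Y))
            (∙-cancelʳ (x ⁻¹) _ _) Y-finite)

        outside : Carrier → Carrier
        outside = proj₁ ∘ escape

        R-infinite : ∀ hs → Infinite setoid (λ x → All (λ h → x ∈ ⟦ R h ⟧) hs)
        -- The neighbourhood also tests `outside x` for each `x` in `xs`. The `b` obtained agrees on
        -- `hs`, so it equals some such `x`; agreement at `outside x` then puts that point into `Y`.
        R-infinite hs (_ , xs , _ , cover)
          with _ , (b , b∈X , Z≐Xb⁻¹) , lift agree
            ← Y∈cl (basic setoid (hs ++ map outside xs) Y) (basic-neighbourhood setoid _ Y) =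
          Allₚ.All¬⇒¬Any {P = b ≈_}
            (All.map (λ {x} e b≈x → let _ , kx∈X , k∉Y = escape x in
              k∉Y (from e (Subset.resp X (∙-congˡ (sym b≈x)) kx∈X)))
              (Allₚ.map⁻ (Allₚ.++⁻ʳ hs agree′)))
            (cover (All.map (λ e → b∈X , e ∷ []) (Allₚ.++⁻ˡ hs agree′)))
          where
          agree′ : b ∈ ⟦ Agreeing (hs ++ map outside xs) Y X ⟧
          agree′ = All.map (λ e → mk⇔
            (to (∈-·ʳ⁻¹ X b) ∘ proj₁ Z≐Xb⁻¹ ∘ to e)
            (from e ∘ proj₂ Z≐Xb⁻¹ ∘ from (∈-·ʳ⁻¹ X b))) agree

        p : FreeUltrafilter setoid
        p = proj₁ (∃-freeUltrafilter setoid R R-infinite)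

        R∈p : ∀ h → R h ∈ ⟦ family p ⟧
        R∈p = proj₂ (∃-freeUltrafilter setoid R R-infinite)

        open FreeUltrafilter p using (isUltrafilter)
        open IsUltrafilter isUltrafilter

      scattered⇔ : ∀ A → Scattered A ⇔
        (∀ B → ⟦ B ⟧ ⊆ ⟦ A ⟧ → Satisfiable ⟦ B ⟧ →
          ∃[ Y ] Finite setoid ⟦ Y ⟧ × Y ∈ Closure setoid (Quotients B))
      scattered⇔ A = mk⇔ scattered⇒ ⇒scattered
        where
        scattered⇒ : Scattered A → ∀ B → ⟦ B ⟧ ⊆ ⟦ A ⟧ → Satisfiable ⟦ B ⟧ →
          ∃[ Y ] Finite setoid ⟦ Y ⟧ × Y ∈ Closure setoid (Quotients B)
        scattered⇒ scattered B B⊆A (b , b∈B) with em {P = Finite setoid ⟦ B ⟧}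
        ... | no infinite =
          let p , B∈p , fin = scattered B B⊆A infinite
          in lim p B , Finite-lim p B fin , lim∈Closure p B B∈p
        -- `Scattered` speaks of infinite subsets only; for finite `B` the quotient Bb⁻¹ is itself a
        -- finite point of the closure.
        ... | yes fin = B ·ʳ (b ⁻¹) ,
          Finite-injection setoid setoid (_∙ b) (to (∈-·ʳ⁻¹ B b)) (∙-cancelʳ b _ _) fin ,
          λ N (F , agree⊆N) → B ·ʳ (b ⁻¹) , (b , b∈B , ≐-refl) ,
            agree⊆N (All.universal (λ _ → mk⇔ id id) F)

        ⇒scattered : (∀ B → ⟦ B ⟧ ⊆ ⟦ A ⟧ → Satisfiable ⟦ B ⟧ →
          ∃[ Y ] Finite setoid ⟦ Y ⟧ × Y ∈ Closure setoid (Quotients B)) → Scattered A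
        ⇒scattered limits X X⊆A infinite =
          let Y , fin , Y∈cl = limits X X⊆A (Infinite⇒Satisfiable setoid infinite)
              p , p-lim      = finite-limit⇒ultrafilter X Y infinite fin Y∈cl
          -- Every index gives `X ∈ p`; `ε` is merely one at hand.
          in p , proj₁ (p-lim ε) , Finite-Δ p X Y fin (proj₂ ∘ p-lim)

theorem4p2 : (∀ {a} → ExcludedMiddle a) →
    (∀ {a ℓ₁ ℓ₂} → ZornsLemma a ℓ₁ ℓ₂) →
    ∀ {c ℓ} (G : Group c ℓ) →
    let open Group G using (setoid)
        open GroupNotions G in
    Infinite setoid U →
    (A : SubsetG) →
    ((n : ℕ) → Thin n A ⇔ (∀ Y → Y ∈ W A → AtMost setoid n ⟦ Y ⟧)) ×
    (Sparse A ⇔ (∀ Y → Y ∈ W A → Finite setoid ⟦ Y ⟧)) ×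
    (Scattered A ⇔
      (∀ (B : SubsetG) → ⟦ B ⟧ ⊆ ⟦ A ⟧ → Satisfiable ⟦ B ⟧ →
        ∃[ Y ] Finite setoid ⟦ Y ⟧ × Y ∈ Closure setoid (Quotients B)))
theorem4p2 em zorn G _ A =
  (λ n → thin⇔ em zorn G n A) , sparse⇔ em zorn G A , scattered⇔ em zorn G A
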